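{- Let $\gamma\ge 0$ and let $f:2^{[n]}\to\mathbb{R}_{\ge 0}$ be a non-negative, monotone, $\gamma$-meta-submodular set function that is also supermodular. Then its multilinear extension $F:[0,1]^n\to\mathbb{R}$ is one-sided $(\max\{3\gamma,2\gamma+1\})$-smooth.
   Context: $[n]=\{1,\dots,n\}$; $S+i=S\cup\{i\}$, $S-i=S\setminus\{i\}$ (operations applied from left to right). For a set function $f$ on $2^{[n]}$, define $B_i(S)=f(S+i)-f(S-i)$ and $A_{ij}(S)=B_j(S+i)-B_j(S-i)=f(S+i+j)-f(S+i-j)-f(S-i+j)+f(S-i-j)$ (so $A_{ii}(S)=0$). For $\gamma\ge 0$, $f$ is $\gamma$-meta-submodular if for every nonempty $S\subseteq[n]$ and all $i,j\in[n]$, $A_{ij}(S)\le\gamma\,\frac{B_i(S)+B_j(S)}{|S|}$. $f$ is monotone if all $B_i(S)\ge 0$ and supermodular if all $A_{ij}(S)\ge 0$. The multilinear extension is $F(x)=\sum_{R\subseteq[n]} f(R)\prod_{v\in R}x_v\prod_{v\in[n]\setminus R}(1-x_v)$. A twice continuously differentiable $F:[0,1]^n\to\mathbb{R}$ is one-sided $\sigma$-smooth at $x\ne\vec 0$ if for every $u\in[0,1]^n$, $\frac12 u^\top\nabla^2F(x)u\le\sigma\,\frac{\|u\|_1}{\|x\|_1}\,u^\top\nabla F(x)$; $F$ is one-sided $\sigma$-smooth if this holds at every non-zero $x\in[0,1]^n$. -}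

module Defs where

open import Algebra.Bundles using (CommutativeRing; Semiring)
import Algebra.Construct.NaturalChoice.Max as Max
import Algebra.Definitions.RawSemiring as RawSemiringDefinitions
open import Data.Bool.Base using (if_then_else_; true; false)
open import Data.Fin.Base using (Fin)
open import Data.Fin.Subset using (Subset; ⁅_⁆; _∪_; ∁; ∣_∣; Nonempty) renaming (_-_ to _-ₛ_)
open import Data.Nat.Base as ℕ using (ℕ; zero; suc)
open import Data.Product.Base using (Σ; ∃; _×_)
open import Data.Vec.Base using ([]; _∷_; lookup)
open import Data.Vec.Functional using (Vector; updateAt)
open import Function.Base using (_∘_)
open import Level using (Level) renaming (_⊔_ to _⊔ˡ_; suc to lsuc)
open import Relation.Binary.Bundles using (TotalOrder)
open import Relation.Binary.Construct.NonStrictToStrict using () renaming (_<_ to Strict)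
open import Relation.Binary.Core using (Rel)
open import Relation.Binary.Structures using (IsDecTotalOrder)
open import Relation.Nullary.Negation using (¬_)
open import Relation.Unary using (Pred)

-- The real numbers of classical mathematics, through their usual
-- characterisation as the Dedekind-complete ordered field.

record OrderedField (c ℓ₁ ℓ₂ : Level) : Set (lsuc (c ⊔ˡ ℓ₁ ⊔ˡ ℓ₂)) where
  infix  4 _≤_ _<_
  infixl 7 _/_
  infix  8 _⁻¹
  field
    commutativeRing : CommutativeRing c ℓ₁
  open CommutativeRing commutativeRing public
  field
    _≤_             : Rel Carrier ℓ₂
    isDecTotalOrder : IsDecTotalOrder _≈_ _≤_
    +-monoˡ-≤       : ∀ z {x y} → x ≤ y → x + z ≤ y + z
    *-nonNegative   : ∀ {x y} → 0# ≤ x → 0# ≤ y → 0# ≤ x * y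
    0≉1             : 0# ≉ 1#
    -- The value of 0# ⁻¹ is unconstrained.
    _⁻¹             : Carrier → Carrier
    ⁻¹-inverseʳ     : ∀ {x} → x ≉ 0# → x * x ⁻¹ ≈ 1#

  module ≤ = IsDecTotalOrder isDecTotalOrder

  totalOrder : TotalOrder c ℓ₁ ℓ₂
  totalOrder = record { isTotalOrder = ≤.isTotalOrder }

  _<_ : Rel Carrier (ℓ₁ ⊔ˡ ℓ₂)
  _<_ = Strict _≈_ _≤_

  _/_ : Carrier → Carrier → Carrier
  x / y = x * y ⁻¹

  UpperBound : ∀ {p} → Pred Carrier p → Pred Carrier (c ⊔ˡ ℓ₂ ⊔ˡ p)
  UpperBound P b = ∀ {x} → P x → x ≤ b

  Supremum : ∀ {p} → Pred Carrier p → Pred Carrier (c ⊔ˡ ℓ₂ ⊔ˡ p)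
  Supremum P s = UpperBound P s × (∀ {b} → UpperBound P b → s ≤ b)

record RealNumbers (c ℓ₁ ℓ₂ : Level) : Set (lsuc (c ⊔ˡ ℓ₁ ⊔ˡ ℓ₂)) where
  field
    orderedField : OrderedField c ℓ₁ ℓ₂
  open OrderedField orderedField public
  field
    complete : (P : Pred Carrier (c ⊔ˡ ℓ₁ ⊔ˡ ℓ₂)) →
               ∃ P → ∃ (UpperBound P) → ∃ (Supremum P)

module _ {c ℓ₁ ℓ₂ : Level} (ℝ : RealNumbers c ℓ₁ ℓ₂) where

  open RealNumbers ℝ

  module RealDefinitions where

    open Max totalOrder public using (_⊔_)
    open RawSemiringDefinitions (Semiring.rawSemiring semiring) public
      using (sum; product) renaming (_×_ to _·_)

    abs : Carrier → Carrier
    abs x = x ⊔ - x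

    fromℕ : ℕ → Carrier
    fromℕ k = k · 1#

    Point : ℕ → Set c
    Point n = Vector Carrier n

    ‖_‖₁ : ∀ {n} → Point n → Carrier
    ‖ x ‖₁ = sum (abs ∘ x)

    _∙_ : ∀ {n} → Point n → Point n → Carrier
    u ∙ v = sum (λ i → u i * v i)

    quadraticForm : ∀ {n} → (Fin n → Fin n → Carrier) → Point n → Carrier
    quadraticForm M u = u ∙ (λ i → M i ∙ u)

    InCube : ∀ {n} → Point n → Set ℓ₂
    InCube x = ∀ i → 0# ≤ x i × x i ≤ 1#

    NonZeroPoint : ∀ {n} → Point n → Set ℓ₁
    NonZeroPoint x = ¬ (∀ i → x i ≈ 0#)

  open RealDefinitions

  module SetFunction {n : ℕ} (f : Subset n → Carrier) where

    infixl 5 _+ₛ_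
    _+ₛ_ : Subset n → Fin n → Subset n
    S +ₛ i = S ∪ ⁅ i ⁆

    B : Fin n → Subset n → Carrier
    B i S = f (S +ₛ i) - f (S -ₛ i)

    A : Fin n → Fin n → Subset n → Carrier
    A i j S = B j (S +ₛ i) - B j (S -ₛ i)

    NonNegative : Set ℓ₂
    NonNegative = ∀ S → 0# ≤ f S

    Monotone : Set ℓ₂
    Monotone = ∀ i S → 0# ≤ B i S

    Supermodular : Set ℓ₂
    Supermodular = ∀ i j S → 0# ≤ A i j S

    MetaSubmodular : Carrier → Set ℓ₂
    MetaSubmodular γ = ∀ S → Nonempty S → ∀ i j →
      A i j S ≤ γ * ((B i S + B j S) / fromℕ ∣ S ∣)

  open SetFunction public using (NonNegative; Monotone; Supermodular; MetaSubmodular)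

  sumSubsets : ∀ {n} → (Subset n → Carrier) → Carrier
  sumSubsets {zero}  g = g []
  sumSubsets {suc n} g = sumSubsets (g ∘ (true ∷_)) + sumSubsets (g ∘ (false ∷_))

  productOver : ∀ {n} → Subset n → (Fin n → Carrier) → Carrier
  productOver R g = product (λ v → if lookup R v then g v else 1#)

  multilinearExtension : ∀ {n} → (Subset n → Carrier) → Point n → Carrier
  multilinearExtension f x =
    sumSubsets (λ R → f R * (productOver R x * productOver (∁ R) (λ v → 1# - x v)))

  -- A function on the cube [0,1]ⁿ is represented by a function on all of
  -- ℝⁿ whose values outside the cube are never consulted; in particular
  -- derivatives on the boundary of the cube are one-sided.

  module _ {n : ℕ} where

    ContinuousOnCube : (Point n → Carrier) → Set (c ⊔ˡ ℓ₁ ⊔ˡ ℓ₂)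
    ContinuousOnCube F =
      ∀ x → InCube x → ∀ ε → 0# < ε →
      ∃ λ δ → 0# < δ × (∀ y → InCube y →
        (∀ i → abs (y i - x i) < δ) → abs (F y - F x) < ε)

    -- G is the partial derivative ∂F/∂xᵢ on the cube.
    IsPartialDerivative : Fin n → (F G : Point n → Carrier) → Set (c ⊔ˡ ℓ₁ ⊔ˡ ℓ₂)
    IsPartialDerivative i F G =
      ∀ x → InCube x → ∀ ε → 0# < ε →
      ∃ λ δ → 0# < δ × (∀ h → h ≉ 0# → abs h < δ →
        let x′ = updateAt x i (_+ h) in
        InCube x′ → abs ((F x′ - F x) / h - G x) < ε)

    record TwiceContinuouslyDifferentiable (F : Point n → Carrier) :
           Set (c ⊔ˡ ℓ₁ ⊔ˡ ℓ₂) where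
      field
        ∇  : Point n → Fin n → Carrier
        ∇² : Point n → Fin n → Fin n → Carrier
        ∇-isGradient  : ∀ i → IsPartialDerivative i F (λ x → ∇ x i)
        ∇²-isHessian  : ∀ i j → IsPartialDerivative i (λ x → ∇ x j) (λ x → ∇² x i j)
        F-continuous  : ContinuousOnCube F
        ∇-continuous  : ∀ i → ContinuousOnCube (λ x → ∇ x i)
        ∇²-continuous : ∀ i j → ContinuousOnCube (λ x → ∇² x i j)

    OneSidedSmoothAt : Carrier → {F : Point n → Carrier} →
                       TwiceContinuouslyDifferentiable F → Point n → Set (c ⊔ˡ ℓ₂)
    OneSidedSmoothAt σ F-C² x =
      ∀ u → InCube u →
      (1# / fromℕ 2) * quadraticForm (∇² x) u ≤ σ * (‖ u ‖₁ / ‖ x ‖₁) * (u ∙ ∇ x)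
      where open TwiceContinuouslyDifferentiable F-C²

    -- The derivatives of F on the cube are unique, so asking for the
    -- inequality with some choice of them is no weaker than with every choice.
    OneSidedSmooth : Carrier → (Point n → Carrier) → Set (c ⊔ˡ ℓ₁ ⊔ˡ ℓ₂)
    OneSidedSmooth σ F =
      Σ (TwiceContinuouslyDifferentiable F) λ F-C² →
      ∀ x → InCube x → NonZeroPoint x → OneSidedSmoothAt σ F-C² x

{-# OPTIONS --safe #-}
module Submission where

-- For a random R containing each v independently with probability x v, the
-- gradient and the Hessian of F at x are E[Bᵢ(R)] and E[Aᵢⱼ(R)], so it suffices
-- that ‖x‖₁ E[Aᵢⱼ(R)] ≤ σ E[Bᵢ(R) + Bⱼ(R)].  Since Aᵢⱼ ≥ 0, the left side is at
-- most the expectation of the sum over k ∈ R of Aᵢⱼ(R) + Aᵢⱼ(R − k), and each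
-- summand is at most (σ / |R|) (Bᵢ(R) + Bⱼ(R)).  For |R| ≥ 2 this is
-- meta-submodularity at R and at R − k, with |R| ≤ 2 (|R| − 1) and with Bᵢ, Bⱼ
-- monotone by supermodularity, and it costs 3γ.  For |R| = 1, supermodularity
-- gives Aᵢⱼ(∅) ≤ Aᵢⱼ(R) + Bⱼ(R), and the cost is 2γ + 1.

open import Defs
open import Algebra.Bundles using (CommutativeRing; RawRing)
import Algebra.Construct.NaturalChoice.Max as Max
import Algebra.Properties.AbelianGroup as AbelianGroupProperties
import Algebra.Properties.CommutativeMonoid.Sum as CommutativeMonoidSum
import Algebra.Properties.CommutativeSemigroup as CommutativeSemigroupProperties
import Algebra.Properties.Ring as RingProperties
import Algebra.Properties.Semiring.Mult.TCOptimised as Multiples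
import Algebra.Properties.Semiring.Sum as SemiringSum
import Algebra.Solver.Ring as RingSolver
open import Algebra.Solver.Ring.AlmostCommutativeRing
  using (fromCommutativeRing; _-Raw-AlmostCommutative⟶_)
open import Data.Bool.Base using (true; false; if_then_else_)
open import Data.Empty using (⊥-elim)
open import Data.Fin.Base using (Fin; zero; suc)
open import Data.Fin.Properties using () renaming (_≟_ to _≟ᶠ_)
open import Data.Fin.Subset using (Subset; ∁; ∣_∣; Nonempty; _∪_; ⁅_⁆) renaming (_-_ to _-ₛ_)
open import Data.Fin.Subset.Properties using (∪-identityʳ; p─⊥≡p; nonempty?; Empty-unique; ∣⊥∣≡0)
open import Data.Maybe.Base using (Maybe; just; nothing)
open import Data.Nat.Base as ℕ using (ℕ; zero; suc)
import Data.Nat.Properties as ℕ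
open import Data.Product.Base using (∃; _×_; _,_; proj₁; proj₂)
open import Data.Sum.Base using (inj₁; inj₂)
open import Data.Vec.Base using ([]; _∷_; lookup; _[_]≔_)
open import Data.Vec.Functional using (updateAt)
open import Data.Vec.Properties using ([]≔-idempotent; []≔-commutes; []≔-lookup)
open import Function.Base using (_∘_)
open import Relation.Binary.Bundles using (Poset)
open import Relation.Binary.PropositionalEquality.Core as ≡ using (_≡_)
import Relation.Binary.Reasoning.PartialOrder as PartialOrderReasoning
import Relation.Binary.Reasoning.Setoid as SetoidReasoning
open import Relation.Nullary.Decidable.Core using (yes; no)

-- Ring equations with integer coefficients

-- The coefficient (m , n) stands for the integer m − n.  Its value is computed
-- by cancellation because the solver compares normal forms up to conversion.
module CommutativeRingSolver {c ℓ} (R : CommutativeRing c ℓ) where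

  open CommutativeRing R
  open Multiples semiring using (×-homo-+; ×1-homo-*) renaming (_×_ to _×′_)
  open CommutativeSemigroupProperties +-commutativeSemigroup using (interchange)
  open AbelianGroupProperties +-abelianGroup using (⁻¹-anti-homo‿-; ⁻¹-∙-comm; ε⁻¹≈ε)
  open RingProperties ring using (-‿distribˡ-*; -‿distribʳ-*; -‿involutive)
  open SetoidReasoning setoid

  private
    Difference : RawRing _ _
    Difference = record
      { Carrier = ℕ × ℕ
      ; _≈_     = _≡_
      ; _+_     = λ (a , b) (c , d) → a ℕ.+ c , b ℕ.+ d
      ; _*_     = λ (a , b) (c , d) → a ℕ.* c ℕ.+ b ℕ.* d , a ℕ.* d ℕ.+ b ℕ.* c
      ; -_      = λ (a , b) → b , a
      ; 0#      = 0 , 0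
      ; 1#      = 1 , 0
      }

    ν : ℕ → Carrier
    ν m = m ×′ 1#

    ⟦_⟧ : ℕ × ℕ → Carrier
    ⟦ m     , zero ⟧  = ν m
    ⟦ zero  , suc n ⟧ = - ν (suc n)
    ⟦ suc m , suc n ⟧ = ⟦ m , n ⟧

    -‿interchange : ∀ a b c d → (a + c) - (b + d) ≈ (a - b) + (c - d)
    -‿interchange a b c d =
      trans (+-congˡ (sym (⁻¹-∙-comm b d))) (interchange a c (- b) (- d))

    -- Cancelling a common successor leaves a difference unchanged. The homomorphism laws can
    -- therefore be checked on differences, without following the cancellation.
    ⟦⟧≈- : ∀ m n → ⟦ m , n ⟧ ≈ ν m - ν n
    ⟦⟧≈- m       zero    = sym (trans (+-congˡ ε⁻¹≈ε) (+-identityʳ _))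
    ⟦⟧≈- zero    (suc n) = sym (+-identityˡ _)
    ⟦⟧≈- (suc m) (suc n) = begin
      ⟦ m , n ⟧                 ≈⟨ ⟦⟧≈- m n ⟩
      ν m - ν n                 ≈⟨ +-identityˡ _ ⟨
      0# + (ν m - ν n)          ≈⟨ +-congʳ (-‿inverseʳ 1#) ⟨
      (1# - 1#) + (ν m - ν n)   ≈⟨ -‿interchange 1# 1# (ν m) (ν n) ⟨
      (1# + ν m) - (1# + ν n)   ≈⟨ +-cong (×-homo-+ 1# 1 m) (-‿cong (×-homo-+ 1# 1 n)) ⟨
      ν (suc m) - ν (suc n)     ∎

    *-difference : ∀ a b c d → (a * c + b * d) - (a * d + b * c) ≈ (a - b) * (c - d)
    *-difference a b c d = begin
      (a * c + b * d) - (a * d + b * c)         ≈⟨ -‿interchange (a * c) (a * d) (b * d) (b * c) ⟩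
      (a * c - a * d) + (b * d - b * c)         ≈⟨ +-congˡ (+-comm (b * d) (- (b * c))) ⟩
      (a * c - a * d) + (- (b * c) + b * d)     ≈⟨ +-cong (+-congˡ (-‿distribʳ-* a d))
                                                     (+-cong (-‿distribˡ-* b c)
                                                       (trans (sym (-‿involutive (b * d)))
                                                         (trans (-‿cong (-‿distribʳ-* b d)) (-‿distribˡ-* b (- d))))) ⟩
      (a * c + a * - d) + (- b * c + - b * - d) ≈⟨ +-cong (distribˡ a c (- d)) (distribˡ (- b) c (- d)) ⟨
      a * (c - d) + - b * (c - d)               ≈⟨ distribʳ (c - d) a (- b) ⟨
      (a - b) * (c - d)                         ∎

    homomorphism : Difference -Raw-AlmostCommutative⟶ fromCommutativeRing R
    homomorphism = record
      { ⟦_⟧    = ⟦_⟧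
      ; +-homo = λ (a , b) (c , d) → begin
          ⟦ a ℕ.+ c , b ℕ.+ d ⟧     ≈⟨ ⟦⟧≈- (a ℕ.+ c) (b ℕ.+ d) ⟩
          ν (a ℕ.+ c) - ν (b ℕ.+ d) ≈⟨ +-cong (×-homo-+ 1# a c) (-‿cong (×-homo-+ 1# b d)) ⟩
          (ν a + ν c) - (ν b + ν d) ≈⟨ -‿interchange (ν a) (ν b) (ν c) (ν d) ⟩
          (ν a - ν b) + (ν c - ν d) ≈⟨ +-cong (⟦⟧≈- a b) (⟦⟧≈- c d) ⟨
          ⟦ a , b ⟧ + ⟦ c , d ⟧     ∎
      ; *-homo = λ (a , b) (c , d) → begin
          ⟦ a ℕ.* c ℕ.+ b ℕ.* d , a ℕ.* d ℕ.+ b ℕ.* c ⟧     ≈⟨ ⟦⟧≈- (a ℕ.* c ℕ.+ b ℕ.* d) (a ℕ.* d ℕ.+ b ℕ.* c) ⟩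
          ν (a ℕ.* c ℕ.+ b ℕ.* d) - ν (a ℕ.* d ℕ.+ b ℕ.* c) ≈⟨ +-cong (ν-+-* a c b d) (-‿cong (ν-+-* a d b c)) ⟩
          (ν a * ν c + ν b * ν d) - (ν a * ν d + ν b * ν c) ≈⟨ *-difference (ν a) (ν b) (ν c) (ν d) ⟩
          (ν a - ν b) * (ν c - ν d)                         ≈⟨ *-cong (⟦⟧≈- a b) (⟦⟧≈- c d) ⟨
          ⟦ a , b ⟧ * ⟦ c , d ⟧                             ∎
      ; -‿homo = λ (a , b) → begin
          ⟦ b , a ⟧     ≈⟨ ⟦⟧≈- b a ⟩
          ν b - ν a     ≈⟨ ⁻¹-anti-homo‿- (ν a) (ν b) ⟨
          - (ν a - ν b) ≈⟨ -‿cong (⟦⟧≈- a b) ⟨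
          - ⟦ a , b ⟧   ∎
      ; 0-homo = refl
      ; 1-homo = refl
      }
      where
      ν-+-* : ∀ a c b d → ν (a ℕ.* c ℕ.+ b ℕ.* d) ≈ ν a * ν c + ν b * ν d
      ν-+-* a c b d = trans (×-homo-+ 1# (a ℕ.* c) (b ℕ.* d)) (+-cong (×1-homo-* a c) (×1-homo-* b d))

    -- Many pairs denote the same integer, so equality is tested by cross-addition: a - b = c - d as
    -- soon as a + d = c + b in `ℕ`.
    equal? : ∀ p q → Maybe (⟦ p ⟧ ≈ ⟦ q ⟧)
    equal? (a , b) (c , d) with a ℕ.+ d ℕ.≟ c ℕ.+ b
    ... | no _  = nothing
    ... | yes e = just (begin
      ⟦ a , b ⟧                 ≈⟨ ⟦⟧≈- a b ⟩
      ν a - ν b                 ≈⟨ shift a b d ⟩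
      ν (a ℕ.+ d) - (ν b + ν d) ≡⟨ ≡.cong (λ k → ν k - (ν b + ν d)) e ⟩
      ν (c ℕ.+ b) - (ν b + ν d) ≈⟨ +-congˡ (-‿cong (+-comm (ν b) (ν d))) ⟩
      ν (c ℕ.+ b) - (ν d + ν b) ≈⟨ shift c d b ⟨
      ν c - ν d                 ≈⟨ ⟦⟧≈- c d ⟨
      ⟦ c , d ⟧                 ∎)
      where
      shift : ∀ a b d → ν a - ν b ≈ ν (a ℕ.+ d) - (ν b + ν d)
      shift a b d = sym (begin
        ν (a ℕ.+ d) - (ν b + ν d)   ≈⟨ +-congʳ (×-homo-+ 1# a d) ⟩
        (ν a + ν d) - (ν b + ν d)   ≈⟨ -‿interchange (ν a) (ν b) (ν d) (ν d) ⟩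
        (ν a - ν b) + (ν d - ν d)   ≈⟨ +-congˡ (-‿inverseʳ (ν d)) ⟩
        (ν a - ν b) + 0#            ≈⟨ +-identityʳ _ ⟩
        ν a - ν b                   ∎)

  open RingSolver Difference (fromCommutativeRing R) homomorphism equal? public
    using (solve; Polynomial; _:=_; _:+_; _:*_; _:-_; :-_; con)

  :0 :1 : ∀ {n} → Polynomial n
  :0 = con (0 , 0)
  :1 = con (1 , 0)

-- Ordered-field arithmetic, absolute values and the 1-norm

module RealProperties {c ℓ₁ ℓ₂} (ℝ : RealNumbers c ℓ₁ ℓ₂) where

  open RealNumbers ℝ hiding (zero)
  open RealDefinitions ℝ
  open CommutativeRingSolver commutativeRing public
  open Max totalOrder using (x≤x⊔y; x≤y⊔x; ⊔-lub; ⊔-cong)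
  open RingProperties ring using (-0#≈0#)

  poset : Poset c ℓ₁ ℓ₂
  poset = record { isPartialOrder = ≤.isPartialOrder }

  module ≤-Reasoning = PartialOrderReasoning poset
  open ≤-Reasoning

  +-mono-≤ : ∀ {w x y z} → w ≤ x → y ≤ z → w + y ≤ x + z
  +-mono-≤ {w} {x} {y} {z} w≤x y≤z = begin
    w + y ≤⟨ +-monoˡ-≤ y w≤x ⟩
    x + y ≈⟨ +-comm x y ⟩
    y + x ≤⟨ +-monoˡ-≤ x y≤z ⟩
    z + x ≈⟨ +-comm z x ⟩
    x + z ∎

  +-nonNegative : ∀ {x y} → 0# ≤ x → 0# ≤ y → 0# ≤ x + y
  +-nonNegative {x} {y} 0≤x 0≤y = begin
    0#      ≈⟨ +-identityʳ 0# ⟨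
    0# + 0# ≤⟨ +-mono-≤ 0≤x 0≤y ⟩
    x + y   ∎

  x≤y⇒0≤y-x : ∀ {x y} → x ≤ y → 0# ≤ y - x
  x≤y⇒0≤y-x {x} {y} x≤y = begin
    0#    ≈⟨ -‿inverseʳ x ⟨
    x - x ≤⟨ +-monoˡ-≤ (- x) x≤y ⟩
    y - x ∎

  0≤y-x⇒x≤y : ∀ {x y} → 0# ≤ y - x → x ≤ y
  0≤y-x⇒x≤y {x} {y} 0≤y-x = begin
    x         ≈⟨ +-identityˡ x ⟨
    0# + x    ≤⟨ +-monoˡ-≤ x 0≤y-x ⟩
    y - x + x ≈⟨ solve 2 (λ x y → y :- x :+ x := y) refl x y ⟩
    y         ∎

  neg-mono-≤ : ∀ {x y} → x ≤ y → - y ≤ - x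
  neg-mono-≤ {x} {y} x≤y = 0≤y-x⇒x≤y (begin
    0#        ≤⟨ x≤y⇒0≤y-x x≤y ⟩
    y - x     ≈⟨ solve 2 (λ x y → y :- x := (:- x) :- (:- y)) refl x y ⟩
    - x - - y ∎)

  *-monoˡ-≤ : ∀ {x y z} → 0# ≤ z → x ≤ y → z * x ≤ z * y
  *-monoˡ-≤ {x} {y} {z} 0≤z x≤y = 0≤y-x⇒x≤y (begin
    0#            ≤⟨ *-nonNegative 0≤z (x≤y⇒0≤y-x x≤y) ⟩
    z * (y - x)   ≈⟨ solve 3 (λ x y z → z :* (y :- x) := z :* y :- z :* x) refl x y z ⟩
    z * y - z * x ∎)

  *-monoʳ-≤ : ∀ {x y z} → 0# ≤ z → x ≤ y → x * z ≤ y * z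
  *-monoʳ-≤ {x} {y} {z} 0≤z x≤y = begin
    x * z ≈⟨ *-comm x z ⟩
    z * x ≤⟨ *-monoˡ-≤ 0≤z x≤y ⟩
    z * y ≈⟨ *-comm z y ⟩
    y * z ∎

  x≤0⇒0≤-x : ∀ {x} → x ≤ 0# → 0# ≤ - x
  x≤0⇒0≤-x {x} x≤0 = begin
    0#   ≈⟨ -0#≈0# ⟨
    - 0# ≤⟨ neg-mono-≤ x≤0 ⟩
    - x  ∎

  0≤1 : 0# ≤ 1#
  0≤1 with ≤.total 0# 1#
  ... | inj₁ 0≤1 = 0≤1
  ... | inj₂ 1≤0 = begin
    -- If 1 ≤ 0 then -1 is non-negative, and so is its square, which is 1.
    0#            ≤⟨ *-nonNegative (x≤0⇒0≤-x 1≤0) (x≤0⇒0≤-x 1≤0) ⟩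
    (- 1#) * - 1# ≈⟨ solve 0 ((:- :1) :* (:- :1) := :1) refl ⟩
    1#            ∎

  0<1 : 0# < 1#
  0<1 = 0≤1 , 0≉1

  0<⇒≉0 : ∀ {x} → 0# < x → x ≉ 0#
  0<⇒≉0 (_ , 0≉x) x≈0 = 0≉x (sym x≈0)

  +-positive : ∀ {x y} → 0# < x → 0# ≤ y → 0# < x + y
  +-positive {x} {y} (0≤x , 0≉x) 0≤y =
    +-nonNegative 0≤x 0≤y , λ 0≈x+y → 0≉x (≤.antisym 0≤x (begin
      x      ≈⟨ +-identityʳ x ⟨
      x + 0# ≤⟨ +-mono-≤ ≤.refl 0≤y ⟩
      x + y  ≈⟨ 0≈x+y ⟨
      0#     ∎))

  ⁻¹-inverseˡ : ∀ {x} → x ≉ 0# → x ⁻¹ * x ≈ 1#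
  ⁻¹-inverseˡ {x} x≉0 = trans (*-comm (x ⁻¹) x) (⁻¹-inverseʳ x≉0)

  ⁻¹-positive : ∀ {x} → 0# < x → 0# < x ⁻¹
  ⁻¹-positive {x} 0<x@(0≤x , _) = 0≤x⁻¹ , λ 0≈x⁻¹ → 0≉1 (begin-equality
      0#        ≈⟨ zeroʳ x ⟨
      x * 0#    ≈⟨ *-congˡ 0≈x⁻¹ ⟩
      x * x ⁻¹  ≈⟨ ⁻¹-inverseʳ x≉0 ⟩
      1#        ∎)
    where
    x≉0 = 0<⇒≉0 0<x
    0≤x⁻¹ : 0# ≤ x ⁻¹
    0≤x⁻¹ with ≤.total 0# (x ⁻¹)
    ... | inj₁ 0≤x⁻¹ = 0≤x⁻¹
    -- A non-positive inverse would make the product 1 non-positive.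
    ... | inj₂ x⁻¹≤0 = ⊥-elim (0≉1 (≤.antisym 0≤1 (begin
      1#       ≈⟨ ⁻¹-inverseʳ x≉0 ⟨
      x * x ⁻¹ ≤⟨ *-monoˡ-≤ 0≤x x⁻¹≤0 ⟩
      x * 0#   ≈⟨ zeroʳ x ⟩
      0#       ∎)))

  *-positive : ∀ {x y} → 0# < x → 0# < y → 0# < x * y
  *-positive {x} {y} 0<x@(0≤x , _) (0≤y , 0≉y) = *-nonNegative 0≤x 0≤y , λ 0≈xy → 0≉y (begin-equality
    0#             ≈⟨ zeroʳ (x ⁻¹) ⟨
    x ⁻¹ * 0#      ≈⟨ *-congˡ 0≈xy ⟩
    x ⁻¹ * (x * y) ≈⟨ *-assoc _ _ _ ⟨
    x ⁻¹ * x * y   ≈⟨ *-congʳ (⁻¹-inverseˡ (0<⇒≉0 0<x)) ⟩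
    1# * y         ≈⟨ *-identityˡ y ⟩
    y              ∎)

  *≤⇒≤⁻¹* : ∀ {x y z} → 0# < x → x * y ≤ z → y ≤ x ⁻¹ * z
  *≤⇒≤⁻¹* {x} {y} {z} 0<x xy≤z = begin
    y              ≈⟨ *-identityˡ y ⟨
    1# * y         ≈⟨ *-congʳ (⁻¹-inverseˡ (0<⇒≉0 0<x)) ⟨
    x ⁻¹ * x * y   ≈⟨ *-assoc _ _ _ ⟩
    x ⁻¹ * (x * y) ≤⟨ *-monoˡ-≤ (proj₁ (⁻¹-positive 0<x)) xy≤z ⟩
    x ⁻¹ * z       ∎

  -- This clears the denominator |S| in the definition of meta-submodularity.
  *-*⁻¹-cancel : ∀ {x} y z → x ≉ 0# → x * (y * (z / x)) ≈ y * z
  *-*⁻¹-cancel {x} y z x≉0 = begin-equality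
    x * (y * (z / x))  ≈⟨ solve 4 (λ x y z w → x :* (y :* (z :* w)) := x :* w :* (y :* z)) refl x y z (x ⁻¹) ⟩
    x * x ⁻¹ * (y * z) ≈⟨ *-congʳ (⁻¹-inverseʳ x≉0) ⟩
    1# * (y * z)       ≈⟨ *-identityˡ _ ⟩
    y * z              ∎

  fromℕ-nonNegative : ∀ m → 0# ≤ fromℕ m
  fromℕ-nonNegative zero    = ≤.refl
  fromℕ-nonNegative (suc m) = +-nonNegative 0≤1 (fromℕ-nonNegative m)

  fromℕ-positive : ∀ m → 0# < fromℕ (suc m)
  fromℕ-positive m = +-positive 0<1 (fromℕ-nonNegative m)

  abs-cong : ∀ {x y} → x ≈ y → abs x ≈ abs y
  abs-cong x≈y = ⊔-cong x≈y (-‿cong x≈y)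

  abs≤ : ∀ {x y} → x ≤ y → - x ≤ y → abs x ≤ y
  abs≤ = ⊔-lub

  x≤abs : ∀ x → x ≤ abs x
  x≤abs x = x≤x⊔y x (- x)

  -x≤abs : ∀ x → - x ≤ abs x
  -x≤abs x = x≤y⊔x x (- x)

  0≤x⇒abs≈x : ∀ {x} → 0# ≤ x → abs x ≈ x
  0≤x⇒abs≈x {x} 0≤x = ≤.antisym (abs≤ ≤.refl (≤.trans (begin
    - x  ≤⟨ neg-mono-≤ 0≤x ⟩
    - 0# ≈⟨ -0#≈0# ⟩
    0#   ∎) 0≤x)) (x≤abs x)

  abs-nonNegative : ∀ x → 0# ≤ abs x
  abs-nonNegative x with ≤.total 0# x
  ... | inj₁ 0≤x = ≤.trans 0≤x (x≤abs x)
  ... | inj₂ x≤0 = ≤.trans (x≤0⇒0≤-x x≤0) (-x≤abs x)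

  abs-+ : ∀ x y → abs (x + y) ≤ abs x + abs y
  abs-+ x y = abs≤ (+-mono-≤ (x≤abs x) (x≤abs y)) (begin
    - (x + y)     ≈⟨ solve 2 (λ x y → :- (x :+ y) := (:- x) :+ (:- y)) refl x y ⟩
    - x - y       ≤⟨ +-mono-≤ (-x≤abs x) (-x≤abs y) ⟩
    abs x + abs y ∎)

  abs-* : ∀ x y → abs (x * y) ≤ abs x * abs y
  abs-* x y with ≤.total 0# x
  ... | inj₁ 0≤x = abs≤
    (≤.trans (*-monoˡ-≤ 0≤x (x≤abs y)) |y|-bound)
    (begin
      - (x * y)     ≈⟨ solve 2 (λ x y → :- (x :* y) := x :* (:- y)) refl x y ⟩
      x * - y       ≤⟨ *-monoˡ-≤ 0≤x (-x≤abs y) ⟩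
      x * abs y     ≤⟨ |y|-bound ⟩
      abs x * abs y ∎)
    where |y|-bound = *-monoʳ-≤ (abs-nonNegative y) (x≤abs x)
  ... | inj₂ x≤0 = abs≤
    (begin
      x * y         ≈⟨ solve 2 (λ x y → x :* y := (:- x) :* (:- y)) refl x y ⟩
      - x * - y     ≤⟨ *-monoˡ-≤ 0≤-x (-x≤abs y) ⟩
      - x * abs y   ≤⟨ |y|-bound ⟩
      abs x * abs y ∎)
    (begin
      - (x * y)     ≈⟨ solve 2 (λ x y → :- (x :* y) := (:- x) :* y) refl x y ⟩
      - x * y       ≤⟨ *-monoˡ-≤ 0≤-x (x≤abs y) ⟩
      - x * abs y   ≤⟨ |y|-bound ⟩
      abs x * abs y ∎)
    where
    0≤-x = x≤0⇒0≤-x x≤0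
    |y|-bound = *-monoʳ-≤ (abs-nonNegative y) (-x≤abs x)

  sum-mono-≤ : ∀ {n} {s t : Point n} → (∀ i → s i ≤ t i) → sum s ≤ sum t
  sum-mono-≤ {zero}  s≤t = ≤.refl
  sum-mono-≤ {suc n} s≤t = +-mono-≤ (s≤t zero) (sum-mono-≤ (s≤t ∘ suc))

  sum-nonNegative : ∀ {n} {t : Point n} → (∀ i → 0# ≤ t i) → 0# ≤ sum t
  sum-nonNegative {zero}  0≤t = ≤.refl
  sum-nonNegative {suc n} 0≤t = +-nonNegative (0≤t zero) (sum-nonNegative (0≤t ∘ suc))

  ‖‖₁-positive : ∀ {n} {x : Point n} → NonZeroPoint x → 0# < ‖ x ‖₁
  ‖‖₁-positive {x = x} x≉0 = 0≤‖x‖ , λ 0≈‖x‖ → x≉0 (zeros x 0≈‖x‖)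
    where
    0≤‖x‖ = sum-nonNegative (abs-nonNegative ∘ x)
    -- The first absolute value and the norm of the tail are non-negative with sum 0, so both
    -- vanish; the tail is handled by induction.
    zeros : ∀ {n} (x : Point n) → 0# ≈ ‖ x ‖₁ → ∀ i → x i ≈ 0#
    zeros {suc n} x 0≈‖x‖ = λ where
        zero    → ≤.antisym (≤.trans (x≤abs _) head≤0) (0≤y-x⇒x≤y (begin
          0#              ≤⟨ x≤y⇒0≤y-x (≤.trans (-x≤abs _) head≤0) ⟩
          0# - - x zero   ≈⟨ solve 1 (λ y → :0 :- (:- y) := y :- :0) refl (x zero) ⟩
          x zero - 0#     ∎))
        (suc i) → zeros (x ∘ suc) (≤.antisym 0≤tail tail≤0) i
      where
      0≤tail = sum-nonNegative (abs-nonNegative ∘ x ∘ suc)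
      head≤0 : abs (x zero) ≤ 0#
      head≤0 = begin
        abs (x zero)      ≈⟨ +-identityʳ _ ⟨
        abs (x zero) + 0# ≤⟨ +-mono-≤ ≤.refl 0≤tail ⟩
        ‖ x ‖₁            ≈⟨ 0≈‖x‖ ⟨
        0#                ∎
      tail≤0 : ‖ x ∘ suc ‖₁ ≤ 0#
      tail≤0 = begin
        ‖ x ∘ suc ‖₁      ≈⟨ +-identityˡ _ ⟨
        0# + ‖ x ∘ suc ‖₁ ≤⟨ +-mono-≤ (abs-nonNegative (x zero)) ≤.refl ⟩
        ‖ x ‖₁            ≈⟨ 0≈‖x‖ ⟨
        0#                ∎

-- The multilinear extension as an expectation over random sets

module MultilinearExtension {c ℓ₁ ℓ₂} (ℝ : RealNumbers c ℓ₁ ℓ₂) where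

  open RealNumbers ℝ hiding (zero)
  open RealDefinitions ℝ
  open RealProperties ℝ
  open ≤-Reasoning

  -- E g x is the expectation of g R, where R contains each v independently
  -- with probability x v.
  E : ∀ {n} → (Subset n → Carrier) → Point n → Carrier
  E {zero}  g x = g []
  E {suc n} g x = x zero * E (g ∘ (true ∷_)) (x ∘ suc) + (1# - x zero) * E (g ∘ (false ∷_)) (x ∘ suc)

  -- The discrete derivative `B`, written with vector updates in place of union and difference.
  -- Updates compute along the recursion of `E`, and the iterate `D i (D j f)` is `A i j`.
  D : ∀ {n} → Fin n → (Subset n → Carrier) → Subset n → Carrier
  D i g S = g (S [ i ]≔ true) - g (S [ i ]≔ false)

  E-cong : ∀ {n} {g h : Subset n → Carrier} → (∀ S → g S ≈ h S) → ∀ x → E g x ≈ E h x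
  E-cong {zero}  g≈h x = g≈h []
  E-cong {suc n} g≈h x = +-cong (*-congˡ (E-cong (g≈h ∘ (true ∷_)) (x ∘ suc)))
                                (*-congˡ (E-cong (g≈h ∘ (false ∷_)) (x ∘ suc)))

  E-0 : ∀ {n} (x : Point n) → E (λ _ → 0#) x ≈ 0#
  E-0 {zero}  x = refl
  E-0 {suc n} x = begin-equality
    x zero * E {n} (λ _ → 0#) (x ∘ suc) + (1# - x zero) * E {n} (λ _ → 0#) (x ∘ suc)
      ≈⟨ +-cong (*-congˡ (E-0 (x ∘ suc))) (*-congˡ (E-0 (x ∘ suc))) ⟩
    x zero * 0# + (1# - x zero) * 0#
      ≈⟨ solve 1 (λ p → p :* :0 :+ (:1 :- p) :* :0 := :0) refl (x zero) ⟩
    0# ∎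

  E-+ : ∀ {n} (g h : Subset n → Carrier) x → E (λ S → g S + h S) x ≈ E g x + E h x
  E-+ {zero}  g h x = refl
  E-+ {suc n} g h x = begin-equality
    x zero * E (λ S → g (true ∷ S) + h (true ∷ S)) (x ∘ suc)
      + (1# - x zero) * E (λ S → g (false ∷ S) + h (false ∷ S)) (x ∘ suc)
      ≈⟨ +-cong (*-congˡ (E-+ _ _ (x ∘ suc))) (*-congˡ (E-+ _ _ (x ∘ suc))) ⟩
    x zero * (E (g ∘ (true ∷_)) (x ∘ suc) + E (h ∘ (true ∷_)) (x ∘ suc))
      + (1# - x zero) * (E (g ∘ (false ∷_)) (x ∘ suc) + E (h ∘ (false ∷_)) (x ∘ suc))
      ≈⟨ solve 5 (λ p a b c d → p :* (a :+ b) :+ (:1 :- p) :* (c :+ d)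
                             := (p :* a :+ (:1 :- p) :* c) :+ (p :* b :+ (:1 :- p) :* d))
           refl (x zero) _ _ _ _ ⟩
    E g x + E h x ∎

  E-* : ∀ {n} k (g : Subset n → Carrier) x → E (λ S → k * g S) x ≈ k * E g x
  E-* {zero}  k g x = refl
  E-* {suc n} k g x = begin-equality
    x zero * E (λ S → k * g (true ∷ S)) (x ∘ suc) + (1# - x zero) * E (λ S → k * g (false ∷ S)) (x ∘ suc)
      ≈⟨ +-cong (*-congˡ (E-* k _ (x ∘ suc))) (*-congˡ (E-* k _ (x ∘ suc))) ⟩
    x zero * (k * E (g ∘ (true ∷_)) (x ∘ suc)) + (1# - x zero) * (k * E (g ∘ (false ∷_)) (x ∘ suc))
      ≈⟨ solve 4 (λ p k a b → p :* (k :* a) :+ (:1 :- p) :* (k :* b) := k :* (p :* a :+ (:1 :- p) :* b))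
           refl (x zero) k _ _ ⟩
    k * E g x ∎

  E-sub : ∀ {n} (g h : Subset n → Carrier) x → E (λ S → g S - h S) x ≈ E g x - E h x
  E-sub g h x = begin-equality
    E (λ S → g S - h S) x              ≈⟨ E-cong (λ S → solve 2 (λ a b → a :- b := a :+ (:- :1) :* b) refl (g S) (h S)) x ⟩
    E (λ S → g S + (- 1#) * h S) x     ≈⟨ E-+ _ _ x ⟩
    E g x + E (λ S → (- 1#) * h S) x   ≈⟨ +-congˡ (E-* (- 1#) h x) ⟩
    E g x + (- 1#) * E h x             ≈⟨ solve 2 (λ a b → a :+ (:- :1) :* b := a :- b) refl _ _ ⟩
    E g x - E h x                      ∎

  E-sum : ∀ {m n} (g : Fin m → Subset n → Carrier) x → E (λ S → sum (λ k → g k S)) x ≈ sum (λ k → E (g k) x)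
  E-sum {zero}  g x = E-0 x
  E-sum {suc m} g x = trans (E-+ _ _ x) (+-congˡ (E-sum (g ∘ suc) x))

  0≤1-x : ∀ {n} {x : Point n} → InCube x → ∀ i → 0# ≤ 1# - x i
  0≤1-x x∈□ i = x≤y⇒0≤y-x (proj₂ (x∈□ i))

  1-x≤1 : ∀ {n} {x : Point n} → InCube x → ∀ i → 1# - x i ≤ 1#
  1-x≤1 {x = x} x∈□ i = 0≤y-x⇒x≤y (begin
    0#              ≤⟨ proj₁ (x∈□ i) ⟩
    x i             ≈⟨ solve 1 (λ p → p := :1 :- (:1 :- p)) refl (x i) ⟩
    1# - (1# - x i) ∎)

  E-mono-≤ : ∀ {n} {g h : Subset n → Carrier} → (∀ S → g S ≤ h S) → ∀ {x} → InCube x → E g x ≤ E h x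
  E-mono-≤ {zero}  g≤h x∈□ = g≤h []
  E-mono-≤ {suc n} g≤h x∈□ = +-mono-≤
    (*-monoˡ-≤ (proj₁ (x∈□ zero)) (E-mono-≤ (g≤h ∘ (true ∷_)) (x∈□ ∘ suc)))
    (*-monoˡ-≤ (0≤1-x x∈□ zero) (E-mono-≤ (g≤h ∘ (false ∷_)) (x∈□ ∘ suc)))

  -- The event k ∈ R is independent of R + k, so its probability `x k` can be moved into the
  -- expectation as an indicator; on that event R + k = R.
  E-member : ∀ {n} k (g : Subset n → Carrier) x →
             x k * E (λ R → g (R [ k ]≔ true)) x ≈ E (λ R → if lookup R k then g R else 0#) x
  E-member zero g x = begin-equality
    x zero * (x zero * E (g ∘ (true ∷_)) (x ∘ suc) + (1# - x zero) * E (g ∘ (true ∷_)) (x ∘ suc))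
      ≈⟨ solve 2 (λ p a → p :* (p :* a :+ (:1 :- p) :* a) := p :* a :+ (:1 :- p) :* :0) refl (x zero) _ ⟩
    x zero * E (g ∘ (true ∷_)) (x ∘ suc) + (1# - x zero) * 0#
      ≈⟨ +-congˡ (*-congˡ (E-0 (x ∘ suc))) ⟨
    E (λ R → if lookup R zero then g R else 0#) x ∎
  E-member (suc k) g x = begin-equality
    x (suc k) * (x zero * E (λ R → g (true ∷ R [ k ]≔ true)) (x ∘ suc)
      + (1# - x zero) * E (λ R → g (false ∷ R [ k ]≔ true)) (x ∘ suc))
      ≈⟨ solve 4 (λ q p a b → q :* (p :* a :+ (:1 :- p) :* b) := p :* (q :* a) :+ (:1 :- p) :* (q :* b))
           refl (x (suc k)) (x zero) _ _ ⟩
    x zero * (x (suc k) * E (λ R → g (true ∷ R [ k ]≔ true)) (x ∘ suc))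
      + (1# - x zero) * (x (suc k) * E (λ R → g (false ∷ R [ k ]≔ true)) (x ∘ suc))
      ≈⟨ +-cong (*-congˡ (E-member k (g ∘ (true ∷_)) (x ∘ suc))) (*-congˡ (E-member k (g ∘ (false ∷_)) (x ∘ suc))) ⟩
    E (λ R → if lookup R (suc k) then g R else 0#) x ∎

  -- `E g` is affine in each coordinate, with slope the expected discrete derivative, so the
  -- first-order expansion has no remainder.
  E-updateAt : ∀ {n} i (g : Subset n → Carrier) x h →
               E g (updateAt x i (_+ h)) ≈ E g x + h * E (D i g) x
  E-updateAt zero g x h = begin-equality
    (x zero + h) * t + (1# - (x zero + h)) * s
      ≈⟨ solve 4 (λ p h t s → (p :+ h) :* t :+ (:1 :- (p :+ h)) :* s
                           := (p :* t :+ (:1 :- p) :* s) :+ h :* (p :* (t :- s) :+ (:1 :- p) :* (t :- s)))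
           refl (x zero) h t s ⟩
    E g x + h * (x zero * (t - s) + (1# - x zero) * (t - s))
      ≈⟨ +-congˡ (*-congˡ (+-cong (*-congˡ (E-sub _ _ (x ∘ suc))) (*-congˡ (E-sub _ _ (x ∘ suc))))) ⟨
    E g x + h * E (D zero g) x ∎
    where
    t = E (g ∘ (true ∷_)) (x ∘ suc)
    s = E (g ∘ (false ∷_)) (x ∘ suc)
  E-updateAt (suc i) g x h = begin-equality
    x zero * E (g ∘ (true ∷_)) (updateAt (x ∘ suc) i (_+ h))
      + (1# - x zero) * E (g ∘ (false ∷_)) (updateAt (x ∘ suc) i (_+ h))
      ≈⟨ +-cong (*-congˡ (E-updateAt i (g ∘ (true ∷_)) (x ∘ suc) h)) (*-congˡ (E-updateAt i (g ∘ (false ∷_)) (x ∘ suc) h)) ⟩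
    x zero * (E (g ∘ (true ∷_)) (x ∘ suc) + h * E (D i (g ∘ (true ∷_))) (x ∘ suc))
      + (1# - x zero) * (E (g ∘ (false ∷_)) (x ∘ suc) + h * E (D i (g ∘ (false ∷_))) (x ∘ suc))
      ≈⟨ solve 6 (λ p h a b c d → p :* (a :+ h :* b) :+ (:1 :- p) :* (c :+ h :* d)
                               := (p :* a :+ (:1 :- p) :* c) :+ h :* (p :* b :+ (:1 :- p) :* d))
           refl (x zero) h _ _ _ _ ⟩
    E g x + h * E (D (suc i) g) x ∎

  sumSubsets-cong : ∀ {n} {g h : Subset n → Carrier} → (∀ S → g S ≈ h S) →
                    sumSubsets ℝ g ≈ sumSubsets ℝ h
  sumSubsets-cong {zero}  g≈h = g≈h []
  sumSubsets-cong {suc n} g≈h = +-cong (sumSubsets-cong (g≈h ∘ (true ∷_))) (sumSubsets-cong (g≈h ∘ (false ∷_)))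

  *-distribˡ-sumSubsets : ∀ {n} k (g : Subset n → Carrier) →
                          sumSubsets ℝ (λ S → k * g S) ≈ k * sumSubsets ℝ g
  *-distribˡ-sumSubsets {zero}  k g = refl
  *-distribˡ-sumSubsets {suc n} k g =
    trans (+-cong (*-distribˡ-sumSubsets {n} k _) (*-distribˡ-sumSubsets {n} k _)) (sym (distribˡ k _ _))

  -- Splitting the subsets by membership of the first element pulls out the common factor `x zero`
  -- or `1# - x zero` and leaves the multilinear extension in one variable fewer.
  multilinearExtension≈E : ∀ {n} (f : Subset n → Carrier) x → multilinearExtension ℝ f x ≈ E f x
  multilinearExtension≈E {zero}  f x = solve 1 (λ a → a :* (:1 :* :1) := a) refl (f [])
  multilinearExtension≈E {suc n} f x = +-cong
    (begin-equality
      sumSubsets ℝ (λ R → f (true ∷ R) * (x zero * P R * (1# * Q R)))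
        ≈⟨ sumSubsets-cong (λ R → solve 4 (λ a p P Q → a :* (p :* P :* (:1 :* Q)) := p :* (a :* (P :* Q)))
             refl (f (true ∷ R)) (x zero) (P R) (Q R)) ⟩
      sumSubsets ℝ (λ R → x zero * (f (true ∷ R) * (P R * Q R)))
        ≈⟨ *-distribˡ-sumSubsets {n} (x zero) _ ⟩
      x zero * multilinearExtension ℝ (f ∘ (true ∷_)) (x ∘ suc)
        ≈⟨ *-congˡ (multilinearExtension≈E (f ∘ (true ∷_)) (x ∘ suc)) ⟩
      x zero * E (f ∘ (true ∷_)) (x ∘ suc) ∎)
    (begin-equality
      sumSubsets ℝ (λ R → f (false ∷ R) * (1# * P R * ((1# - x zero) * Q R)))
        ≈⟨ sumSubsets-cong (λ R → solve 4 (λ a p P Q → a :* (:1 :* P :* (p :* Q)) := p :* (a :* (P :* Q)))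
             refl (f (false ∷ R)) (1# - x zero) (P R) (Q R)) ⟩
      sumSubsets ℝ (λ R → (1# - x zero) * (f (false ∷ R) * (P R * Q R)))
        ≈⟨ *-distribˡ-sumSubsets {n} (1# - x zero) _ ⟩
      (1# - x zero) * multilinearExtension ℝ (f ∘ (false ∷_)) (x ∘ suc)
        ≈⟨ *-congˡ (multilinearExtension≈E (f ∘ (false ∷_)) (x ∘ suc)) ⟩
      (1# - x zero) * E (f ∘ (false ∷_)) (x ∘ suc) ∎)
    where
    P Q : Subset n → Carrier
    P R = productOver ℝ R (x ∘ suc)
    Q R = productOver ℝ (∁ R) (λ v → 1# - x (suc v))

  -- Bounds, continuity and derivatives on the cube

  abs-*-unit : ∀ {a z M} → 0# ≤ a → a ≤ 1# → abs z ≤ M → abs (a * z) ≤ M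
  abs-*-unit {a} {z} {M} 0≤a a≤1 |z|≤M = begin
    abs (a * z)   ≤⟨ abs-* a z ⟩
    abs a * abs z ≈⟨ *-congʳ (0≤x⇒abs≈x 0≤a) ⟩
    a * abs z     ≤⟨ *-monoʳ-≤ (abs-nonNegative z) a≤1 ⟩
    1# * abs z    ≈⟨ *-identityˡ _ ⟩
    abs z         ≤⟨ |z|≤M ⟩
    M             ∎

  -- The bound has to be uniform in the point. Both weights lie in [0,1], so the bounds for the two
  -- halves may simply be added.
  E-bounded : ∀ {n} (g : Subset n → Carrier) → ∃ λ M → ∀ {x} → InCube x → abs (E g x) ≤ M
  E-bounded {zero}  g = abs (g []) , λ _ → ≤.refl
  E-bounded {suc n} g with E-bounded (g ∘ (true ∷_)) | E-bounded (g ∘ (false ∷_))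
  ... | M , |t|≤M | N , |s|≤N = M + N , λ x∈□ → ≤.trans (abs-+ _ _) (+-mono-≤
    (abs-*-unit (proj₁ (x∈□ zero)) (proj₂ (x∈□ zero)) (|t|≤M (x∈□ ∘ suc)))
    (abs-*-unit (0≤1-x x∈□ zero) (1-x≤1 x∈□ zero) (|s|≤N (x∈□ ∘ suc))))

  -- By induction on the dimension: the two tail expectations are Lipschitz, and moving the first
  -- coordinate costs at most a bound on their difference.
  E-lipschitz : ∀ {n} (g : Subset n → Carrier) → ∃ λ L → 0# ≤ L × (∀ {x y} → InCube x → InCube y →
                ∀ {δ} → (∀ i → abs (y i - x i) ≤ δ) → abs (E g y - E g x) ≤ L * δ)
  E-lipschitz {zero}  g = 0# , ≤.refl , λ _ _ {δ} _ → begin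
    abs (g [] - g []) ≈⟨ abs-cong (-‿inverseʳ (g [])) ⟩
    abs 0#            ≈⟨ 0≤x⇒abs≈x ≤.refl ⟩
    0#                ≈⟨ zeroˡ δ ⟨
    0# * δ            ∎
  E-lipschitz {suc n} g with E-lipschitz (g ∘ (true ∷_)) | E-lipschitz (g ∘ (false ∷_)) | E-bounded (λ S → g (true ∷ S) - g (false ∷ S))
  ... | L , 0≤L , lipₜ | K , 0≤K , lipₛ | M , |t-s|≤M =
    -- The absolute value of `M` makes the constant non-negative without exhibiting a point of the
    -- cube.
    L + K + abs M , +-nonNegative (+-nonNegative 0≤L 0≤K) (abs-nonNegative M) , lip
    where
    lip : ∀ {x y} → InCube x → InCube y → ∀ {δ} → (∀ i → abs (y i - x i) ≤ δ) →
          abs (E g y - E g x) ≤ (L + K + abs M) * δ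
    lip {x} {y} x∈□ y∈□ {δ} near = begin
      abs (E g y - E g x)
        -- The change is split in two: the tails move under the new weights, then the first
        -- coordinate moves with the tails held at their old values.
        ≈⟨ abs-cong (solve 6 (λ p q t s t′ s′ →
             (q :* t′ :+ (:1 :- q) :* s′) :- (p :* t :+ (:1 :- p) :* s)
             := (q :* (t′ :- t) :+ (:1 :- q) :* (s′ :- s)) :+ (q :- p) :* (t :- s))
             refl (x zero) (y zero) t s t′ s′) ⟩
      abs (y zero * (t′ - t) + (1# - y zero) * (s′ - s) + (y zero - x zero) * (t - s))
        ≤⟨ ≤.trans (abs-+ _ _) (+-mono-≤ (abs-+ _ _) (abs-* _ _)) ⟩
      abs (y zero * (t′ - t)) + abs ((1# - y zero) * (s′ - s)) + abs (y zero - x zero) * abs (t - s)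
        ≤⟨ +-mono-≤ (+-mono-≤
             (abs-*-unit (proj₁ (y∈□ zero)) (proj₂ (y∈□ zero)) (lipₜ (x∈□ ∘ suc) (y∈□ ∘ suc) (near ∘ suc)))
             (abs-*-unit (0≤1-x y∈□ zero) (1-x≤1 y∈□ zero) (lipₛ (x∈□ ∘ suc) (y∈□ ∘ suc) (near ∘ suc))))
             (≤.trans (*-monoˡ-≤ (abs-nonNegative _) |t-s|≤|M|) (*-monoʳ-≤ (abs-nonNegative M) (near zero))) ⟩
      L * δ + K * δ + δ * abs M
        ≈⟨ solve 4 (λ L K M δ → L :* δ :+ K :* δ :+ δ :* M := (L :+ K :+ M) :* δ) refl L K (abs M) δ ⟩
      (L + K + abs M) * δ ∎
      where
      t = E (g ∘ (true ∷_)) (x ∘ suc)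
      s = E (g ∘ (false ∷_)) (x ∘ suc)
      t′ = E (g ∘ (true ∷_)) (y ∘ suc)
      s′ = E (g ∘ (false ∷_)) (y ∘ suc)
      |t-s|≤|M| : abs (t - s) ≤ abs M
      |t-s|≤|M| = begin
        abs (t - s) ≈⟨ abs-cong (E-sub _ _ (x ∘ suc)) ⟨
        abs (E (λ S → g (true ∷ S) - g (false ∷ S)) (x ∘ suc)) ≤⟨ |t-s|≤M (x∈□ ∘ suc) ⟩
        M           ≤⟨ x≤abs M ⟩
        abs M       ∎

  module _ {n} {g : Subset n → Carrier} {F : Point n → Carrier} (F≈E : ∀ x → F x ≈ E g x) where

    continuous : ContinuousOnCube ℝ F
    continuous x x∈□ ε 0<ε with E-lipschitz g
    ... | L , 0≤L , lip = δ , 0<δ , λ y y∈□ near → begin-strict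
        abs (F y - F x)     ≈⟨ abs-cong (+-cong (F≈E y) (-‿cong (F≈E x))) ⟩
        abs (E g y - E g x) ≤⟨ lip x∈□ y∈□ (proj₁ ∘ near) ⟩
        L * δ               <⟨ Lδ<ε ⟩
        ε                   ∎
      where
      0<L+1 : 0# < 1# + L
      0<L+1 = +-positive 0<1 0≤L
      -- Dividing by 1 + L covers L = 0 and leaves room for strictness: ε exceeds Lδ by exactly δ >
      -- 0.
      δ = (1# + L) ⁻¹ * ε
      0<δ : 0# < δ
      0<δ = *-positive (⁻¹-positive 0<L+1) 0<ε
      ε≈δ+Lδ : ε ≈ δ + L * δ
      ε≈δ+Lδ = begin-equality
        ε                             ≈⟨ *-identityˡ ε ⟨
        1# * ε                        ≈⟨ *-congʳ (⁻¹-inverseʳ (0<⇒≉0 0<L+1)) ⟨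
        (1# + L) * (1# + L) ⁻¹ * ε    ≈⟨ solve 3 (λ L i ε → (:1 :+ L) :* i :* ε := i :* ε :+ L :* (i :* ε)) refl L ((1# + L) ⁻¹) ε ⟩
        δ + L * δ                     ∎
      ε-Lδ≈δ : ε - L * δ ≈ δ
      ε-Lδ≈δ = begin-equality
        ε - L * δ           ≈⟨ +-congʳ ε≈δ+Lδ ⟩
        δ + L * δ - L * δ   ≈⟨ solve 2 (λ δ k → δ :+ k :- k := δ) refl δ (L * δ) ⟩
        δ                   ∎
      Lδ<ε : L * δ < ε
      Lδ<ε = 0≤y-x⇒x≤y (≤.trans (proj₁ 0<δ) (≤.reflexive (sym ε-Lδ≈δ))) , λ Lδ≈ε → proj₂ 0<δ (begin-equality
        0#            ≈⟨ -‿inverseʳ ε ⟨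
        ε - ε         ≈⟨ +-congˡ (-‿cong Lδ≈ε) ⟨
        ε - L * δ     ≈⟨ ε-Lδ≈δ ⟩
        δ             ∎)

    partialDerivative : ∀ i → IsPartialDerivative ℝ i F (E (D i g))
    -- The difference quotient equals the derivative exactly, so any positive δ works; 1 is taken
    -- for every ε.
    partialDerivative i x x∈□ ε 0<ε = 1# , 0<1 , λ h h≉0 _ _ → begin-strict
      abs ((F (updateAt x i (_+ h)) - F x) / h - E (D i g) x) ≈⟨ abs-cong (exact h h≉0) ⟩
      abs 0#                                                  ≈⟨ 0≤x⇒abs≈x ≤.refl ⟩
      0#                                                      <⟨ 0<ε ⟩
      ε                                                       ∎
      where
      exact : ∀ h → h ≉ 0# → (F (updateAt x i (_+ h)) - F x) / h - E (D i g) x ≈ 0#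
      exact h h≉0 = begin-equality
        (F (updateAt x i (_+ h)) - F x) / h - d ≈⟨ +-congʳ (*-congʳ (+-cong (trans (F≈E _) (E-updateAt i g x h)) (-‿cong (F≈E x)))) ⟩
        (E g x + h * d - E g x) * h ⁻¹ - d      ≈⟨ solve 4 (λ a h d i → (a :+ h :* d :- a) :* i :- d := h :* i :* d :- d) refl (E g x) h d (h ⁻¹) ⟩
        h * h ⁻¹ * d - d                        ≈⟨ +-congʳ (*-congʳ (⁻¹-inverseʳ h≉0)) ⟩
        1# * d - d                              ≈⟨ solve 1 (λ d → :1 :* d :- d := :0) refl d ⟩
        0#                                      ∎
        where d = E (D i g) x

  -- Each partial derivative is again an expectation, of `D j f`, so the facts about `E` apply a
  -- second time and give the Hessian.
  twiceContinuouslyDifferentiable : ∀ {n} (f : Subset n → Carrier) →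
                                    TwiceContinuouslyDifferentiable ℝ (multilinearExtension ℝ f)
  twiceContinuouslyDifferentiable f = record
    { ∇             = λ x i → E (D i f) x
    ; ∇²            = λ x i j → E (D i (D j f)) x
    ; ∇-isGradient  = partialDerivative (multilinearExtension≈E f)
    ; ∇²-isHessian  = λ i j → partialDerivative {g = D j f} (λ _ → refl) i
    ; F-continuous  = continuous (multilinearExtension≈E f)
    ; ∇-continuous  = λ i → continuous {g = D i f} (λ _ → refl)
    ; ∇²-continuous = λ i j → continuous {g = D i (D j f)} (λ _ → refl)
    }

-- Set operations as updates of Boolean vectors

∪⁅⁆≡[]≔true : ∀ {n} (S : Subset n) i → S ∪ ⁅ i ⁆ ≡ S [ i ]≔ true
∪⁅⁆≡[]≔true (true  ∷ S) zero    = ≡.cong (true ∷_) (∪-identityʳ S)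
∪⁅⁆≡[]≔true (false ∷ S) zero    = ≡.cong (true ∷_) (∪-identityʳ S)
∪⁅⁆≡[]≔true (true  ∷ S) (suc i) = ≡.cong (true ∷_) (∪⁅⁆≡[]≔true S i)
∪⁅⁆≡[]≔true (false ∷ S) (suc i) = ≡.cong (false ∷_) (∪⁅⁆≡[]≔true S i)

-ₛ≡[]≔false : ∀ {n} (S : Subset n) i → S -ₛ i ≡ S [ i ]≔ false
-ₛ≡[]≔false (b ∷ S) zero    = ≡.cong (false ∷_) (p─⊥≡p S)
-ₛ≡[]≔false (b ∷ S) (suc i) = ≡.cong (b ∷_) (-ₛ≡[]≔false S i)

∣S∣≡1+∣S[k]≔false∣ : ∀ {n} (S : Subset n) k → lookup S k ≡ true → ∣ S ∣ ≡ suc ∣ S [ k ]≔ false ∣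
∣S∣≡1+∣S[k]≔false∣ (true  ∷ S) zero    k∈S = ≡.refl
∣S∣≡1+∣S[k]≔false∣ (true  ∷ S) (suc k) k∈S = ≡.cong suc (∣S∣≡1+∣S[k]≔false∣ S k k∈S)
∣S∣≡1+∣S[k]≔false∣ (false ∷ S) (suc k) k∈S = ∣S∣≡1+∣S[k]≔false∣ S k k∈S

[]≔-lookup-≡ : ∀ {n b} (S : Subset n) k → lookup S k ≡ b → S [ k ]≔ b ≡ S
[]≔-lookup-≡ S k ≡.refl = []≔-lookup S k

module _ {c ℓ₁ ℓ₂} (ℝ : RealNumbers c ℓ₁ ℓ₂) where

  open RealNumbers ℝ hiding (zero)
  open RealDefinitions ℝ
  open RealProperties ℝ
  open MultilinearExtension ℝ
  open CommutativeMonoidSum +-commutativeMonoid using (sum-cong-≋; ∑-distrib-+)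
  open SemiringSum semiring using (*-distribˡ-sum; *-distribʳ-sum)
  open Max totalOrder using (x≤x⊔y; x≤y⊔x)
  open ≤-Reasoning

  -- Averaging over the members of the random set

  sum-members-≤ : ∀ {n} (R : Subset n) (g : Point n) {s} → (∀ k → lookup R k ≡ true → g k ≤ s) →
                  sum (λ k → if lookup R k then g k else 0#) ≤ fromℕ ∣ R ∣ * s
  sum-members-≤ [] g {s} g≤s = ≤.reflexive (sym (zeroˡ s))
  sum-members-≤ (true ∷ R) g {s} g≤s = begin
    g zero + sum (λ k → if lookup R k then g (suc k) else 0#) ≤⟨ +-mono-≤ (g≤s zero ≡.refl) (sum-members-≤ R (g ∘ suc) (g≤s ∘ suc)) ⟩
    s + fromℕ ∣ R ∣ * s                                       ≈⟨ solve 2 (λ m s → s :+ m :* s := (:1 :+ m) :* s) refl (fromℕ ∣ R ∣) s ⟩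
    (1# + fromℕ ∣ R ∣) * s                                    ∎
  sum-members-≤ (false ∷ R) g {s} g≤s = begin
    0# + sum (λ k → if lookup R k then g (suc k) else 0#) ≈⟨ +-identityˡ _ ⟩
    sum (λ k → if lookup R k then g (suc k) else 0#)      ≤⟨ sum-members-≤ R (g ∘ suc) (g≤s ∘ suc) ⟩
    fromℕ ∣ R ∣ * s                                       ∎

  -- Each of the |R| terms is at most t / |R|. For empty R the sum is 0, which is where 0 ≤ t
  -- enters.
  sum-members-≤-average : ∀ {n} (R : Subset n) (g : Point n) {t} → 0# ≤ t →
                          (∀ k → lookup R k ≡ true → fromℕ ∣ R ∣ * g k ≤ t) →
                          sum (λ k → if lookup R k then g k else 0#) ≤ t
  sum-members-≤-average R g {t} 0≤t g≤t with ∣ R ∣ in ∣R∣≡m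
  ... | zero = begin
    -- A set of size 0 has no member k, so the termwise bound by 0 is vacuous.
    sum (λ k → if lookup R k then g k else 0#) ≤⟨ sum-members-≤ R g {0#} (λ k k∈R → ⊥-elim (ℕ.0≢1+n (≡.trans (≡.sym ∣R∣≡m) (∣S∣≡1+∣S[k]≔false∣ R k k∈R)))) ⟩
    fromℕ ∣ R ∣ * 0#                           ≈⟨ zeroʳ _ ⟩
    0#                                         ≤⟨ 0≤t ⟩
    t                                          ∎
  ... | suc m = begin
    sum (λ k → if lookup R k then g k else 0#) ≤⟨ sum-members-≤ R g (λ k k∈R → *≤⇒≤⁻¹* 0<m (g≤t k k∈R)) ⟩
    fromℕ ∣ R ∣ * (fromℕ (suc m) ⁻¹ * t)       ≡⟨ ≡.cong (λ l → fromℕ l * (fromℕ (suc m) ⁻¹ * t)) ∣R∣≡m ⟩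
    fromℕ (suc m) * (fromℕ (suc m) ⁻¹ * t)     ≈⟨ *-assoc _ _ t ⟨
    fromℕ (suc m) * fromℕ (suc m) ⁻¹ * t       ≈⟨ *-congʳ (⁻¹-inverseʳ (0<⇒≉0 0<m)) ⟩
    1# * t                                     ≈⟨ *-identityˡ t ⟩
    t                                          ∎
    where 0<m = fromℕ-positive m

  -- If k ∈ R, the difference of the two sides is `D k g R`; otherwise both sides agree.
  remove-≤ : ∀ {n} k (g : Subset n → Carrier) → (∀ S → 0# ≤ D k g S) → ∀ R → g (R [ k ]≔ false) ≤ g R
  remove-≤ k g 0≤Dg R with lookup R k in k∈?R
  ... | false = ≤.reflexive (reflexive (≡.cong g ([]≔-lookup-≡ R k k∈?R)))
  ... | true  = begin
    g (R [ k ]≔ false) ≤⟨ 0≤y-x⇒x≤y (0≤Dg R) ⟩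
    g (R [ k ]≔ true)  ≡⟨ ≡.cong g ([]≔-lookup-≡ R k k∈?R) ⟩
    g R                ∎

  -- The proof of ‖x‖₁ E[a(R)] ≤ E[t(R)] from a pointwise hypothesis: conditioning
  -- on k gives x k · E[a(R)] ≤ x k · E[a(R + k) + a(R − k)], and for any h the
  -- product x k · E[h(R + k)] is the part of E[h(R)] with k ∈ R.
  ‖‖₁*E-≤ : ∀ {n} {a t : Subset n → Carrier} → (∀ S → 0# ≤ a S) → (∀ S → 0# ≤ t S) →
            (∀ R k → lookup R k ≡ true → fromℕ ∣ R ∣ * (a R + a (R [ k ]≔ false)) ≤ t R) →
            ∀ {x} → InCube x → ‖ x ‖₁ * E a x ≤ E t x
  ‖‖₁*E-≤ {n} {a} {t} 0≤a 0≤t a≤t {x} x∈□ = begin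
    ‖ x ‖₁ * E a x                                            ≈⟨ *-distribʳ-sum (E a x) (abs ∘ x) ⟩
    sum (λ k → abs (x k) * E a x)                             ≤⟨ sum-mono-≤ step ⟩
    sum (λ k → E (λ R → if lookup R k then g k R else 0#) x)  ≈⟨ E-sum (λ k R → if lookup R k then g k R else 0#) x ⟨
    E (λ R → sum (λ k → if lookup R k then g k R else 0#)) x  ≤⟨ E-mono-≤ (λ R → sum-members-≤-average R (λ k → g k R) (0≤t R) (a≤t R)) x∈□ ⟩
    E t x                                                     ∎
    where
    g : Fin n → Subset n → Carrier
    g k R = a R + a (R [ k ]≔ false)

    -- R is one of R + k and R - k, and the value of `a` at the other one is non-negative.
    a≤g : ∀ k R → a R ≤ g k (R [ k ]≔ true)
    a≤g k R with lookup R k in k∈?R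
    ... | true  = begin
      a R                    ≡⟨ ≡.cong a ([]≔-lookup-≡ R k k∈?R) ⟨
      a (R [ k ]≔ true)      ≈⟨ +-identityʳ _ ⟨
      a (R [ k ]≔ true) + 0# ≤⟨ +-mono-≤ ≤.refl (0≤a _) ⟩
      g k (R [ k ]≔ true)    ∎
    ... | false = begin
      a R                                 ≡⟨ ≡.cong a (≡.trans ([]≔-idempotent R k) ([]≔-lookup-≡ R k k∈?R)) ⟨
      a (R [ k ]≔ true [ k ]≔ false)      ≈⟨ +-identityˡ _ ⟨
      0# + a (R [ k ]≔ true [ k ]≔ false) ≤⟨ +-mono-≤ (0≤a _) ≤.refl ⟩
      g k (R [ k ]≔ true)                 ∎

    step : ∀ k → abs (x k) * E a x ≤ E (λ R → if lookup R k then g k R else 0#) x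
    step k = begin
      abs (x k) * E a x                              ≈⟨ *-congʳ (0≤x⇒abs≈x (proj₁ (x∈□ k))) ⟩
      x k * E a x                                    ≤⟨ *-monoˡ-≤ (proj₁ (x∈□ k)) (E-mono-≤ (a≤g k) x∈□) ⟩
      x k * E (λ R → g k (R [ k ]≔ true)) x          ≈⟨ E-member k (g k) x ⟩
      E (λ R → if lookup R k then g k R else 0#) x   ∎

  -- Weighting the entrywise bound by u i · u j and summing, the terms b i and b j each contribute
  -- ‖u‖₁ (u ∙ b). The resulting factor 2 later cancels the one half in the definition of
  -- smoothness.
  quadraticForm-≤ : ∀ {n} {H : Fin n → Fin n → Carrier} {b : Point n} {X σ} →
                    (∀ i j → X * H i j ≤ σ * (b i + b j)) →
                    ∀ {u} → (∀ i → 0# ≤ u i) → X * quadraticForm H u ≤ fromℕ 2 * (σ * (sum u * (u ∙ b)))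
  quadraticForm-≤ {n} {H} {b} {X} {σ} H≤b {u} 0≤u = begin
    X * quadraticForm H u
      ≈⟨ *-distribˡ-sum {n} X _ ⟩
    sum (λ i → X * (u i * (H i ∙ u)))
      ≤⟨ sum-mono-≤ row ⟩
    sum (λ i → σ * sum u * (u i * b i) + u i * (σ * (u ∙ b)))
      ≈⟨ ∑-distrib-+ {n} _ _ ⟩
    sum (λ i → σ * sum u * (u i * b i)) + sum (λ i → u i * (σ * (u ∙ b)))
      ≈⟨ +-cong (*-distribˡ-sum {n} _ _) (*-distribʳ-sum {n} _ u) ⟨
    σ * sum u * (u ∙ b) + sum u * (σ * (u ∙ b))
      -- The polynomial spells out 1 + (1 + 0) because that is what `fromℕ 2` unfolds to.
      ≈⟨ solve 3 (λ σ U V → σ :* U :* V :+ U :* (σ :* V) := (:1 :+ (:1 :+ :0)) :* (σ :* (U :* V))) refl σ (sum u) (u ∙ b) ⟩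
    fromℕ 2 * (σ * (sum u * (u ∙ b))) ∎
    where
    entry : ∀ i j → X * (H i j * u j) ≤ σ * b i * u j + σ * (u j * b j)
    entry i j = begin
      X * (H i j * u j)                 ≈⟨ *-assoc _ _ _ ⟨
      X * H i j * u j                   ≤⟨ *-monoʳ-≤ (0≤u j) (H≤b i j) ⟩
      σ * (b i + b j) * u j             ≈⟨ solve 4 (λ σ p q u → σ :* (p :+ q) :* u := σ :* p :* u :+ σ :* (u :* q)) refl σ (b i) (b j) (u j) ⟩
      σ * b i * u j + σ * (u j * b j)   ∎

    row : ∀ i → X * (u i * (H i ∙ u)) ≤ σ * sum u * (u i * b i) + u i * (σ * (u ∙ b))
    row i = begin
      X * (u i * (H i ∙ u))
        ≈⟨ solve 3 (λ X u h → X :* (u :* h) := u :* (X :* h)) refl X (u i) (H i ∙ u) ⟩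
      u i * (X * (H i ∙ u))
        ≈⟨ *-congˡ (*-distribˡ-sum {n} X _) ⟩
      u i * sum (λ j → X * (H i j * u j))
        ≤⟨ *-monoˡ-≤ (0≤u i) (sum-mono-≤ (entry i)) ⟩
      u i * sum (λ j → σ * b i * u j + σ * (u j * b j))
        ≈⟨ *-congˡ (∑-distrib-+ {n} _ _) ⟩
      u i * (sum (λ j → σ * b i * u j) + sum (λ j → σ * (u j * b j)))
        ≈⟨ *-congˡ (+-cong (*-distribˡ-sum {n} _ u) (*-distribˡ-sum {n} σ _)) ⟨
      u i * (σ * b i * sum u + σ * (u ∙ b))
        ≈⟨ solve 5 (λ u σ b U V → u :* (σ :* b :* U :+ σ :* V) := σ :* U :* (u :* b) :+ u :* (σ :* V)) refl (u i) σ (b i) (sum u) (u ∙ b) ⟩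
      σ * sum u * (u i * b i) + u i * (σ * (u ∙ b)) ∎

  -- Pointwise bounds on the second differences

  module _ {n : ℕ} {γ : Carrier} {f : Subset n → Carrier} (0≤γ : 0# ≤ γ)
           (monotone : Monotone ℝ f) (meta : MetaSubmodular ℝ f γ) (supermodular : Supermodular ℝ f) where

    open SetFunction ℝ f using (A; B)

    private
      σ : Carrier
      σ = (3 · γ) ⊔ (2 · γ + 1#)

      B≡D : ∀ i S → B i S ≡ D i f S
      B≡D i S = ≡.cong₂ (λ P Q → f P - f Q) (∪⁅⁆≡[]≔true S i) (-ₛ≡[]≔false S i)

      A≡DD : ∀ i j S → A i j S ≡ D i (D j f) S
      A≡DD i j S = ≡.cong₂ _-_
        (≡.trans (B≡D j _) (≡.cong (D j f) (∪⁅⁆≡[]≔true S i)))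
        (≡.trans (B≡D j _) (≡.cong (D j f) (-ₛ≡[]≔false S i)))

    D-nonNegative : ∀ i S → 0# ≤ D i f S
    D-nonNegative i S = ≡.subst (0# ≤_) (B≡D i S) (monotone i S)

    DD-nonNegative : ∀ i j S → 0# ≤ D i (D j f) S
    DD-nonNegative i j S = ≡.subst (0# ≤_) (A≡DD i j S) (supermodular i j S)

    -- With the denominator cleared, meta-submodularity extends to the empty set: the left side is
    -- then 0, and monotonicity makes the right side non-negative.
    ∣S∣*DD-≤ : ∀ i j S → fromℕ ∣ S ∣ * D i (D j f) S ≤ γ * (D i f S + D j f S)
    ∣S∣*DD-≤ i j S with ∣ S ∣ in ∣S∣≡m
    ... | zero  = begin
      0# * D i (D j f) S        ≈⟨ zeroˡ _ ⟩
      0#                        ≤⟨ *-nonNegative 0≤γ (+-nonNegative (D-nonNegative i S) (D-nonNegative j S)) ⟩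
      γ * (D i f S + D j f S)   ∎
    ... | suc m = begin
      fromℕ (suc m) * D i (D j f) S                             ≡⟨ ≡.cong (fromℕ (suc m) *_) (A≡DD i j S) ⟨
      fromℕ (suc m) * A i j S                                   ≤⟨ *-monoˡ-≤ (fromℕ-nonNegative (suc m)) (meta S S≢∅ i j) ⟩
      fromℕ (suc m) * (γ * ((B i S + B j S) / fromℕ ∣ S ∣))     ≡⟨ ≡.cong (λ l → fromℕ (suc m) * (γ * ((B i S + B j S) / fromℕ l))) ∣S∣≡m ⟩
      fromℕ (suc m) * (γ * ((B i S + B j S) / fromℕ (suc m)))   ≈⟨ *-*⁻¹-cancel γ _ (0<⇒≉0 (fromℕ-positive m)) ⟩
      γ * (B i S + B j S)                                       ≡⟨ ≡.cong₂ (λ p q → γ * (p + q)) (B≡D i S) (B≡D j S) ⟩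
      γ * (D i f S + D j f S)                                   ∎
      where
      S≢∅ : Nonempty S
      S≢∅ with nonempty? S
      ... | yes S≢∅ = S≢∅
      ... | no S≡∅  = ⊥-elim (ℕ.0≢1+n (≡.trans (≡.sym (≡.trans (≡.cong ∣_∣ (Empty-unique S≡∅)) (∣⊥∣≡0 n))) ∣S∣≡m))

    -- For k = i the later update overwrites the earlier one and both sides agree. Otherwise the
    -- updates commute, and supermodularity makes `D j f` increasing in k.
    D-add-mono : ∀ i j k R → D j f (R [ k ]≔ false [ i ]≔ true) ≤ D j f (R [ i ]≔ true)
    D-add-mono i j k R with k ≟ᶠ i
    ... | yes ≡.refl = ≤.reflexive (reflexive (≡.cong (D j f) ([]≔-idempotent R k)))
    ... | no k≢i     = begin
      D j f (R [ k ]≔ false [ i ]≔ true) ≡⟨ ≡.cong (D j f) ([]≔-commutes R k i k≢i) ⟩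
      D j f (R [ i ]≔ true [ k ]≔ false) ≤⟨ remove-≤ k (D j f) (DD-nonNegative k j) _ ⟩
      D j f (R [ i ]≔ true)              ∎

    -- This replaces the meta-submodularity of f at R − k when that set is empty.
    DD-remove-≤ : ∀ i j k R → D i (D j f) (R [ k ]≔ false) ≤ D i (D j f) R + D j f R
    DD-remove-≤ i j k R = begin
      p - q                                     ≤⟨ 0≤y-x⇒x≤y (begin
        0#                                        ≤⟨ D-nonNegative j _ ⟩
        q                                         ≈⟨ solve 2 (λ p q → q := p :- (p :- q)) refl p q ⟩
        p - (p - q)                               ∎) ⟩
      p                                         ≤⟨ D-add-mono i j k R ⟩
      r                                         ≈⟨ solve 2 (λ r s → r := r :- s :+ s) refl r s ⟩
      r - s + s                                 ≤⟨ +-mono-≤ ≤.refl (remove-≤ i (D j f) (DD-nonNegative i j) R) ⟩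
      D i (D j f) R + D j f R                   ∎
      where
      p = D j f (R [ k ]≔ false [ i ]≔ true)
      q = D j f (R [ k ]≔ false [ i ]≔ false)
      r = D j f (R [ i ]≔ true)
      s = D j f (R [ i ]≔ false)

    pointwise : ∀ i j R k → lookup R k ≡ true →
                fromℕ ∣ R ∣ * (D i (D j f) R + D i (D j f) (R [ k ]≔ false)) ≤ σ * (D i f R + D j f R)
    -- Replacing |R| by 1 + |R - k| lets a single case split on |R - k| separate |R| = 1 from |R| ≥
    -- 2.
    pointwise i j R k k∈R with ∣ R ∣ | ∣S∣≡1+∣S[k]≔false∣ R k k∈R | ∣S∣*DD-≤ i j R
    ... | _ | ≡.refl | metaᴿ with ∣ R [ k ]≔ false ∣ | ∣S∣*DD-≤ i j (R [ k ]≔ false)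
    -- Here R = {k}: a + a′ ≤ 2a + b, and a ≤ γb by meta-submodularity at R, which gives the
    -- constant 2γ + 1.
    ... | zero | _ = begin
      (1# + 0#) * (a + a′)        ≤⟨ *-monoˡ-≤ (fromℕ-nonNegative 1) (+-mono-≤ ≤.refl a′≤a+b) ⟩
      (1# + 0#) * (a + (a + b))   ≈⟨ solve 2 (λ a b → (:1 :+ :0) :* (a :+ (a :+ b)) := (:1 :+ :0) :* a :+ (:1 :+ :0) :* a :+ b) refl a b ⟩
      (1# + 0#) * a + (1# + 0#) * a + b ≤⟨ +-mono-≤ (+-mono-≤ metaᴿ metaᴿ) ≤.refl ⟩
      γ * b + γ * b + b           ≈⟨ solve 2 (λ γ b → γ :* b :+ γ :* b :+ b := (γ :+ (γ :+ :0) :+ :1) :* b) refl γ b ⟩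
      (2 · γ + 1#) * b            ≤⟨ *-monoʳ-≤ 0≤b (x≤y⊔x _ _) ⟩
      σ * b                       ∎
      where
      a = D i (D j f) R
      a′ = D i (D j f) (R [ k ]≔ false)
      b = D i f R + D j f R
      0≤b : 0# ≤ b
      0≤b = +-nonNegative (D-nonNegative i R) (D-nonNegative j R)
      a′≤a+b : a′ ≤ a + b
      a′≤a+b = begin
        a′                      ≤⟨ DD-remove-≤ i j k R ⟩
        a + D j f R             ≈⟨ +-congˡ (+-identityˡ _) ⟨
        -- Monotonicity supplies the missing summand, so that the bound becomes symmetric in i and
        -- j.
        a + (0# + D j f R)      ≤⟨ +-mono-≤ ≤.refl (+-mono-≤ (D-nonNegative i R) ≤.refl) ⟩
        a + b                   ∎
    ... | suc m | metaᵀ = begin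
      (1# + M) * (a + a′)                     ≈⟨ distribˡ _ a a′ ⟩
      -- As M = |R - k| ≥ 1, the factor |R| = 1 + M is at most 2M. One γb comes from R and two come
      -- from R - k.
      (1# + M) * a + (1# + M) * a′            ≤⟨ +-mono-≤ metaᴿ (*-monoʳ-≤ (DD-nonNegative i j _) (+-mono-≤ 1≤M ≤.refl)) ⟩
      γ * b + (M + M) * a′                    ≈⟨ +-congˡ (distribʳ a′ M M) ⟩
      γ * b + (M * a′ + M * a′)               ≤⟨ +-mono-≤ ≤.refl (+-mono-≤ Ma′≤γb Ma′≤γb) ⟩
      γ * b + (γ * b + γ * b)                 ≈⟨ solve 2 (λ γ b → γ :* b :+ (γ :* b :+ γ :* b) := (γ :+ (γ :+ (γ :+ :0))) :* b) refl γ b ⟩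
      (3 · γ) * b                             ≤⟨ *-monoʳ-≤ 0≤b (x≤x⊔y _ _) ⟩
      σ * b                                   ∎
      where
      M = fromℕ (suc m)
      a = D i (D j f) R
      a′ = D i (D j f) (R [ k ]≔ false)
      b = D i f R + D j f R
      0≤b : 0# ≤ b
      0≤b = +-nonNegative (D-nonNegative i R) (D-nonNegative j R)
      1≤M : 1# ≤ M
      1≤M = begin
        1#      ≈⟨ +-identityʳ 1# ⟨
        1# + 0# ≤⟨ +-mono-≤ ≤.refl (fromℕ-nonNegative m) ⟩
        M       ∎
      Ma′≤γb : M * a′ ≤ γ * b
      -- Meta-submodularity at R - k bounds by first differences at R - k; supermodularity carries
      -- these up to R.
      Ma′≤γb = ≤.trans metaᵀ (*-monoˡ-≤ 0≤γ
        (+-mono-≤ (remove-≤ k (D i f) (DD-nonNegative k i) R) (remove-≤ k (D j f) (DD-nonNegative k j) R)))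

    -- From pointwise bounds to one-sided smoothness

    hessian-≤ : ∀ {x} → InCube x → ∀ i j →
                ‖ x ‖₁ * E (D i (D j f)) x ≤ σ * (E (D i f) x + E (D j f) x)
    hessian-≤ {x} x∈□ i j = begin
      ‖ x ‖₁ * E (D i (D j f)) x             ≤⟨ ‖‖₁*E-≤ (DD-nonNegative i j)
                                                  (λ S → *-nonNegative 0≤σ (+-nonNegative (D-nonNegative i S) (D-nonNegative j S)))
                                                  (pointwise i j) x∈□ ⟩
      E (λ S → σ * (D i f S + D j f S)) x    ≈⟨ E-* σ _ x ⟩
      σ * E (λ S → D i f S + D j f S) x      ≈⟨ *-congˡ (E-+ _ _ x) ⟩
      σ * (E (D i f) x + E (D j f) x)        ∎
      where
      0≤σ : 0# ≤ σ
      -- The maximum is at least 3γ, a sum of non-negative terms.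
      0≤σ = ≤.trans (+-nonNegative 0≤γ (+-nonNegative 0≤γ (+-nonNegative 0≤γ ≤.refl))) (x≤x⊔y _ _)

    oneSidedSmooth : OneSidedSmooth ℝ σ (multilinearExtension ℝ f)
    oneSidedSmooth = twiceContinuouslyDifferentiable f , λ x x∈□ x≉0 u u∈□ → smoothAt x∈□ (‖‖₁-positive x≉0) u∈□
      where
      smoothAt : ∀ {x} → InCube x → 0# < ‖ x ‖₁ → ∀ {u} → InCube u →
                 (1# / fromℕ 2) * quadraticForm (λ i j → E (D i (D j f)) x) u
                   ≤ σ * (‖ u ‖₁ / ‖ x ‖₁) * (u ∙ (λ i → E (D i f) x))
      smoothAt {x} x∈□ 0<X {u} u∈□ = begin
        -- The quadratic-form bound is divided by ‖x‖₁, which is positive because x is non-zero.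
        (1# / two) * Q                        ≤⟨ *-monoˡ-≤ (*-nonNegative 0≤1 (proj₁ (⁻¹-positive 0<2))) (*≤⇒≤⁻¹* 0<X
                                                   (quadraticForm-≤ (hessian-≤ x∈□) (proj₁ ∘ u∈□))) ⟩
        (1# / two) * (X ⁻¹ * (two * (σ * (sum u * V))))
          ≈⟨ solve 6 (λ t h i σ U V → :1 :* h :* (i :* (t :* (σ :* (U :* V)))) := t :* h :* (σ :* (U :* i) :* V))
               refl two (two ⁻¹) (X ⁻¹) σ (sum u) V ⟩
        two * two ⁻¹ * (σ * (sum u / X) * V)  ≈⟨ *-congʳ (⁻¹-inverseʳ (0<⇒≉0 0<2)) ⟩
        1# * (σ * (sum u / X) * V)            ≈⟨ *-identityˡ _ ⟩
        -- The coordinates of u are non-negative, so their sum is its 1-norm.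
        σ * (sum u / X) * V                   ≈⟨ *-congʳ (*-congˡ (*-congʳ (sum-cong-≋ (λ i → 0≤x⇒abs≈x (proj₁ (u∈□ i)))))) ⟨
        σ * (‖ u ‖₁ / X) * V                  ∎
        where
        two = fromℕ 2
        0<2 = fromℕ-positive 1
        X = ‖ x ‖₁
        Q = quadraticForm (λ i j → E (D i (D j f)) x) u
        V = u ∙ (λ i → E (D i f) x)

theorem3 : ∀ {c ℓ₁ ℓ₂} (ℝ : RealNumbers c ℓ₁ ℓ₂) →
    let open RealNumbers ℝ
        open RealDefinitions ℝ
    in
    (n : ℕ) (γ : Carrier) (f : Subset n → Carrier) →
    0# ≤ γ →
    NonNegative ℝ f →
    Monotone ℝ f →
    MetaSubmodular ℝ f γ →
    Supermodular ℝ f →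
    OneSidedSmooth ℝ ((3 · γ) ⊔ (2 · γ + 1#)) (multilinearExtension ℝ f)
theorem3 ℝ n γ f 0≤γ _ monotone meta supermodular =
  oneSidedSmooth ℝ 0≤γ monotone meta supermodular
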